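{- Let $G$ be a finite group. If $G$ has a subgroup isomorphic to the dihedral group $D_6$ of order $6$ or to the quaternion group $Q_8$ of order $8$, then $G$ is not strongly sequenceable.
   Context: Let $G$ have identity $e$ and let $S\subseteq G\setminus\{e\}$, $|S|=k$. For an ordering $(g_1,\dots,g_k)$ of the elements of $S$ let $h_0=e$, $h_i=g_1\cdots g_i$. The ordering is an $S$-sequencing if $h_0,\dots,h_k$ are pairwise distinct, and a rotational $S$-sequencing if $h_1,\dots,h_k$ are pairwise distinct and $h_k=e$. The group $G$ is strongly sequenceable if for every $S\subseteq G\setminus\{e\}$ there is an $S$-sequencing or a rotational $S$-sequencing (or both). -}

module Defs where

open import Algebra.Bundles using (Group)
open import Algebra.Morphism.Structures using (IsGroupIsomorphism)
open import Data.Bool.Base using (Bool; true; false; _xor_; if_then_else_)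
open import Data.Bool.Properties renaming (_≟_ to _≟ᵇ_) using ()
open import Data.Fin.Base using (Fin; zero; toℕ)
open import Data.Fin.Properties renaming (_≟_ to _≟ᶠ_) using ()
open import Data.List.Base using (List; []; _∷_; allFin; cartesianProduct; foldl)
open import Data.List.Membership.Propositional using (_∈_)
open import Data.List.Membership.Propositional.Properties using (∈-allFin; ∈-cartesianProduct⁺)
import Data.List.Membership.Setoid as SetoidMembership
import Data.List.NonEmpty.Base as List⁺
open import Data.List.Relation.Unary.All using (all?; lookup; universal)
open import Data.List.Relation.Unary.Any using (here; there)
import Data.List.Relation.Unary.Unique.Setoid as SetoidUnique
open import Data.List.Scans.Base using (scanl; scanl⁺)
open import Data.Nat.Base using (ℕ; _+_; _∸_)
open import Data.Nat.DivMod using (_mod_)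
open import Data.Product.Base using (Σ; ∃; _×_; _,_; proj₁; proj₂)
open import Data.Product.Properties using (≡-dec)
open import Data.Sign.Base as Sign using (Sign)
open import Data.Sign.Properties renaming (_≟_ to _≟ˢ_) using ()
open import Data.Sum.Base using (_⊎_)
open import Function.Base using (_on_)
open import Function.Bundles using (_⇔_; Bijection)
open import Level using (Level; 0ℓ; suc; _⊔_)
open import Relation.Binary.Definitions using (DecidableEquality; _Respects_)
open import Relation.Binary.PropositionalEquality as ≡ using (_≡_; refl)
open import Relation.Nullary.Decidable using (Dec; yes; no; map′; True; toWitness)
open import Relation.Nullary.Negation using (¬_)
open import Relation.Unary using (Pred; Decidable)

private
  variable
    c ℓ c′ ℓ′ : Level

IsFinite : Group c ℓ → Set (c ⊔ ℓ)
IsFinite G = ∃ λ n → Bijection (≡.setoid (Fin n)) (Group.setoid G)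

record Subgroup (p : Level) (G : Group c ℓ) : Set (c ⊔ ℓ ⊔ suc p) where
  open Group G renaming (refl to ≈-refl; sym to ≈-sym; trans to ≈-trans)
  field
    member    : Pred Carrier p
    respects  : member Respects _≈_
    ε-closed  : member ε
    ∙-closed  : ∀ {x y} → member x → member y → member (x ∙ y)
    ⁻¹-closed : ∀ {x} → member x → member (x ⁻¹)

  -- Equality compares underlying elements only, so the choice of membership
  -- proof is irrelevant.
  group : Group (c ⊔ p) ℓ
  group = record
    { Carrier = Σ Carrier member
    ; _≈_     = _≈_ on proj₁
    ; _∙_     = λ (x , x∈) (y , y∈) → x ∙ y , ∙-closed x∈ y∈
    ; ε       = ε , ε-closed
    ; _⁻¹     = λ (x , x∈) → x ⁻¹ , ⁻¹-closed x∈
    ; isGroup = record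
      { isMonoid = record
        { isSemigroup = record
          { isMagma = record
            { isEquivalence = record { refl = ≈-refl ; sym = ≈-sym ; trans = ≈-trans }
            ; ∙-cong        = ∙-cong
            }
          ; assoc = λ x y z → assoc (proj₁ x) (proj₁ y) (proj₁ z)
          }
        ; identity = (λ x → identityˡ (proj₁ x)) , (λ x → identityʳ (proj₁ x))
        }
      ; inverse = (λ x → inverseˡ (proj₁ x)) , (λ x → inverseʳ (proj₁ x))
      ; ⁻¹-cong = ⁻¹-cong
      }
    }

_≅_ : Group c ℓ → Group c′ ℓ′ → Set (c ⊔ ℓ ⊔ c′ ⊔ ℓ′)
G ≅ H = ∃ (IsGroupIsomorphism (Group.rawGroup G) (Group.rawGroup H))

HasSubgroupIsomorphicTo : (p : Level) → Group c ℓ → Group c′ ℓ′ → Set (c ⊔ ℓ ⊔ c′ ⊔ ℓ′ ⊔ suc p)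
HasSubgroupIsomorphicTo p G H = Σ (Subgroup p G) λ K → Subgroup.group K ≅ H

module _ (G : Group c ℓ) where
  open Group G using (Carrier; _≈_; _∙_; ε; setoid)
  open SetoidMembership setoid renaming (_∈_ to _∈ᴳ_) using ()
  open SetoidUnique setoid using (Unique)

  -- A subset of G ∖ {e}. Classically every subset of a finite group is
  -- decidable; requiring it keeps StronglySequenceable from asking for
  -- orderings of subsets with undecidable membership, so that its negation is
  -- not won for merely constructive reasons.
  record NonIdentitySubset : Set (c ⊔ suc ℓ) where
    field
      member   : Pred Carrier ℓ
      respects : member Respects _≈_
      member?  : Decidable member
      ε∉       : ¬ member ε

  IsOrderingOf : NonIdentitySubset → List Carrier → Set (c ⊔ ℓ)
  IsOrderingOf S gs = Unique gs × (∀ x → x ∈ᴳ gs ⇔ NonIdentitySubset.member S x)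

  -- For gs = (g₁ , … , gₖ), scanl _∙_ ε gs = (h₀ , h₁ , … , hₖ), the tail of
  -- the scan is (h₁ , … , hₖ), and foldl _∙_ ε gs = hₖ.
  IsSequencing : NonIdentitySubset → List Carrier → Set (c ⊔ ℓ)
  IsSequencing S gs = IsOrderingOf S gs × Unique (scanl _∙_ ε gs)

  IsRotationalSequencing : NonIdentitySubset → List Carrier → Set (c ⊔ ℓ)
  IsRotationalSequencing S gs =
    IsOrderingOf S gs × Unique (List⁺.tail (scanl⁺ _∙_ ε gs)) × foldl _∙_ ε gs ≈ ε

  StronglySequenceable : Set (c ⊔ suc ℓ)
  StronglySequenceable =
    (S : NonIdentitySubset) → ∃ (IsSequencing S) ⊎ ∃ (IsRotationalSequencing S)

module FiniteGroup
  {A : Set} (_≟_ : DecidableEquality A) (elements : List A) (complete : ∀ x → x ∈ elements)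
  (_·_ : A → A → A) (e : A) (inv : A → A)
  where

  ∀? : {P : A → Set} → (∀ x → Dec (P x)) → Dec (∀ x → P x)
  ∀? P? = map′ (λ ps x → lookup ps (complete x)) (λ f → universal f elements) (all? P? elements)

  assoc? : Dec (∀ x y z → ((x · y) · z) ≡ (x · (y · z)))
  assoc? = ∀? λ x → ∀? λ y → ∀? λ z → ((x · y) · z) ≟ (x · (y · z))

  identityˡ? : Dec (∀ x → (e · x) ≡ x)
  identityˡ? = ∀? λ x → (e · x) ≟ x

  identityʳ? : Dec (∀ x → (x · e) ≡ x)
  identityʳ? = ∀? λ x → (x · e) ≟ x

  inverseˡ? : Dec (∀ x → (inv x · x) ≡ e)
  inverseˡ? = ∀? λ x → (inv x · x) ≟ e

  inverseʳ? : Dec (∀ x → (x · inv x) ≡ e)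
  inverseʳ? = ∀? λ x → (x · inv x) ≟ e

  mkGroup : True assoc? → True identityˡ? → True identityʳ? →
            True inverseˡ? → True inverseʳ? → Group 0ℓ 0ℓ
  mkGroup a il ir vl vr = record
    { Carrier = A
    ; _≈_     = _≡_
    ; _∙_     = _·_
    ; ε       = e
    ; _⁻¹     = inv
    ; isGroup = record
      { isMonoid = record
        { isSemigroup = record
          { isMagma = record { isEquivalence = ≡.isEquivalence ; ∙-cong = ≡.cong₂ _·_ }
          ; assoc   = toWitness a
          }
        ; identity = toWitness il , toWitness ir
        }
      ; inverse = toWitness vl , toWitness vr
      ; ⁻¹-cong = ≡.cong inv
      }
    }

module Dihedral₆ where
  -- (a , b) stands for rᵃ sᵇ, where r³ = s² = e and s r s = r⁻¹; hence
  -- rᵃ sᵇ · rᶜ sᵈ = r^(a ± c) s^(b + d), with minus sign exactly when b = 1.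
  Carrier : Set
  Carrier = Fin 3 × Bool

  _⊕_ : Fin 3 → Fin 3 → Fin 3
  a ⊕ c = (toℕ a + toℕ c) mod 3

  ⊖_ : Fin 3 → Fin 3
  ⊖ a = (3 ∸ toℕ a) mod 3

  _·_ : Carrier → Carrier → Carrier
  (a , b) · (c , d) = a ⊕ (if b then ⊖ c else c) , b xor d

  inv : Carrier → Carrier
  inv (a , b) = (if b then a else ⊖ a) , b

  elements : List Carrier
  elements = cartesianProduct (allFin 3) (false ∷ true ∷ [])

  complete : ∀ x → x ∈ elements
  complete (a , b) = ∈-cartesianProduct⁺ (∈-allFin a) (bools b)
    where
    bools : ∀ b → b ∈ false ∷ true ∷ []
    bools false = here refl
    bools true  = there (here refl)

  group : Group 0ℓ 0ℓ
  group = FiniteGroup.mkGroup (≡-dec _≟ᶠ_ _≟ᵇ_) elements complete _·_ (zero , false) inv _ _ _ _ _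

D₆ : Group 0ℓ 0ℓ
D₆ = Dihedral₆.group

module Quaternion₈ where
  data Basis : Set where
    𝟏 i j k : Basis

  -- (s , u) stands for the signed unit ± u.
  Carrier : Set
  Carrier = Sign × Basis

  _·ᵇ_ : Basis → Basis → Carrier
  𝟏 ·ᵇ v = Sign.+ , v
  u ·ᵇ 𝟏 = Sign.+ , u
  i ·ᵇ i = Sign.- , 𝟏
  i ·ᵇ j = Sign.+ , k
  i ·ᵇ k = Sign.- , j
  j ·ᵇ i = Sign.- , k
  j ·ᵇ j = Sign.- , 𝟏
  j ·ᵇ k = Sign.+ , i
  k ·ᵇ i = Sign.+ , j
  k ·ᵇ j = Sign.- , i
  k ·ᵇ k = Sign.- , 𝟏

  _·_ : Carrier → Carrier → Carrier
  (s , u) · (t , v) = (s Sign.* t) Sign.* proj₁ (u ·ᵇ v) , proj₂ (u ·ᵇ v)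

  inv : Carrier → Carrier
  inv (s , 𝟏) = s , 𝟏
  inv (s , u) = Sign.opposite s , u

  _≟ᵘ_ : DecidableEquality Basis
  𝟏 ≟ᵘ 𝟏 = yes refl
  𝟏 ≟ᵘ i = no λ ()
  𝟏 ≟ᵘ j = no λ ()
  𝟏 ≟ᵘ k = no λ ()
  i ≟ᵘ 𝟏 = no λ ()
  i ≟ᵘ i = yes refl
  i ≟ᵘ j = no λ ()
  i ≟ᵘ k = no λ ()
  j ≟ᵘ 𝟏 = no λ ()
  j ≟ᵘ i = no λ ()
  j ≟ᵘ j = yes refl
  j ≟ᵘ k = no λ ()
  k ≟ᵘ 𝟏 = no λ ()
  k ≟ᵘ i = no λ ()
  k ≟ᵘ j = no λ ()
  k ≟ᵘ k = yes refl

  elements : List Carrier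
  elements = cartesianProduct (Sign.+ ∷ Sign.- ∷ []) (𝟏 ∷ i ∷ j ∷ k ∷ [])

  complete : ∀ x → x ∈ elements
  complete (s , u) = ∈-cartesianProduct⁺ (signs s) (basis u)
    where
    signs : ∀ s → s ∈ Sign.+ ∷ Sign.- ∷ []
    signs Sign.+ = here refl
    signs Sign.- = there (here refl)

    basis : ∀ u → u ∈ 𝟏 ∷ i ∷ j ∷ k ∷ []
    basis 𝟏 = here refl
    basis i = there (here refl)
    basis j = there (there (here refl))
    basis k = there (there (there (here refl)))

  group : Group 0ℓ 0ℓ
  group = FiniteGroup.mkGroup (≡-dec _≟ˢ_ _≟ᵘ_) elements complete _·_ (Sign.+ , 𝟏) inv _ _ _ _ _

Q₈ : Group 0ℓ 0ℓ
Q₈ = Quaternion₈.group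

{-# OPTIONS --safe #-}

-- A subset of a subgroup is also a subset of G, and its orderings and their
-- partial products do not depend on the ambient group; hence strong
-- sequenceability passes to finite subgroups. In D₆ the five non-identity
-- elements, and in Q₈ the six elements ±i, ±j, ±k, admit neither kind of
-- sequencing, as running through all their orderings shows.
module Submission where

open import Defs
open import Algebra.Bundles using (Group)
open import Algebra.Morphism.Structures using (IsGroupMonomorphism; IsGroupIsomorphism)
open import Algebra.Structures using (IsGroup)
import Algebra.Morphism.Construct.Composition as Composition
import Data.Bool.Properties as Bool
import Data.Fin.Properties as Fin
open import Data.List.Base using (List; []; _∷_; [_]; _++_; map; concatMap; drop; foldl)
open import Data.List.Membership.Propositional using (_∈_; lose)
open import Data.List.Membership.Propositional.Properties
  using (∈-∃++; ∈-map⁺; ∈-concatMap⁺)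
import Data.List.Membership.DecPropositional as DecMembership
import Data.List.Membership.Setoid as SetoidMembership
import Data.List.Membership.Setoid.Properties as SetoidMembershipₚ
open import Data.List.Membership.Propositional.Properties.WithK using (unique∧set⇒bag)
import Data.List.NonEmpty.Base as List⁺
open import Data.List.Relation.Binary.BagAndSetEquality using (∼bag⇒↭)
import Data.List.Relation.Binary.Equality.Setoid as SetoidEquality
open import Data.List.Relation.Binary.Permutation.Propositional using (_↭_; ↭-sym)
open import Data.List.Relation.Binary.Permutation.Propositional.Properties
  using (∈-resp-↭; drop-mid; ↭-empty-inv)
open import Data.List.Relation.Binary.Pointwise using ([]; _∷_)
open import Data.List.Relation.Unary.All as All using (All; []; _∷_)
open import Data.List.Relation.Unary.Any as Any using (here; there)
import Data.List.Relation.Unary.Any.Properties as Any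
import Data.List.Relation.Unary.Unique.DecPropositional as DecUnique
import Data.List.Relation.Unary.Unique.Setoid as SetoidUnique
import Data.List.Relation.Unary.Unique.Setoid.Properties as SetoidUniqueₚ
open import Data.List.Scans.Base using (scanl; scanl⁺)
open import Data.Product.Base using (∃; _×_; _,_; proj₁; proj₂)
open import Data.Product.Properties using (≡-dec)
import Data.Sign.Properties as Sign
open import Data.Sign.Base using (+; -)
open import Data.Sum.Base as Sum using (_⊎_; inj₁; inj₂; [_,_]′)
open import Function.Base using (_∘_)
open import Function.Bundles using (mk⇔; module Equivalence)
import Function.Construct.Symmetry as Symmetry
open import Function.Properties.Bijection using (Bijection⇒Inverse)
open import Function.Properties.Inverse using (Inverse⇒Injection)
open import Level using (Level; 0ℓ)
open import Relation.Binary.Definitions using (Decidable; DecidableEquality)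
open import Relation.Binary.PropositionalEquality using (_≡_; refl; subst)
open import Relation.Nullary.Decidable 
  using (Dec; map′; ¬?; True; False; toWitness; toWitnessFalse; _×-dec_)
open import Relation.Nullary.Negation using (¬_)

private
  variable
    a c ℓ c′ ℓ′ p : Level

-- Embedding `H` into `G` through a subgroup isomorphic to `H`

inverse-isGroupMonomorphism :
  (G : Group c ℓ) (H : Group c′ ℓ′) {f : Group.Carrier G → Group.Carrier H}
  (f-iso : IsGroupIsomorphism (Group.rawGroup G) (Group.rawGroup H) f) →
  IsGroupMonomorphism (Group.rawGroup H) (Group.rawGroup G)
    (proj₁ ∘ IsGroupIsomorphism.surjective f-iso)
inverse-isGroupMonomorphism G H {f} f-iso = record
  { isGroupHomomorphism = record
    { isMonoidHomomorphism = record
      { isMagmaHomomorphism = record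
        { isRelHomomorphism = record
          -- The chosen preimages form a section of `f`; each law holds after applying `f`, by
          -- `f∘f⁻¹`, and injectivity of `f` then cancels it.
          { cong = λ x≈y → injective (H.trans (f∘f⁻¹ _) (H.trans x≈y (H.sym (f∘f⁻¹ _)))) }
        ; homo = λ x y → injective (H.trans (f∘f⁻¹ _)
            (H.sym (H.trans (∙-homo _ _) (H.∙-cong (f∘f⁻¹ x) (f∘f⁻¹ y)))))
        }
      ; ε-homo = injective (H.trans (f∘f⁻¹ _) (H.sym ε-homo))
      }
    ; ⁻¹-homo = λ x → injective (H.trans (f∘f⁻¹ _)
        (H.sym (H.trans (⁻¹-homo _) (H.⁻¹-cong (f∘f⁻¹ x)))))
    }
  ; injective = λ {x} {y} eq →
      H.trans (H.sym (f∘f⁻¹ x)) (H.trans (⟦⟧-cong eq) (f∘f⁻¹ y))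
  }
  where
  module G = Group G
  module H = Group H
  open IsGroupIsomorphism f-iso

  f∘f⁻¹ : ∀ y → f (proj₁ (surjective y)) H.≈ y
  f∘f⁻¹ y = proj₂ (surjective y) G.refl

inclusion-isGroupMonomorphism :
  (G : Group c ℓ) (K : Subgroup p G) →
  IsGroupMonomorphism (Group.rawGroup (Subgroup.group K)) (Group.rawGroup G) proj₁
inclusion-isGroupMonomorphism G K = record
  { isGroupHomomorphism = record
    { isMonoidHomomorphism = record
      { isMagmaHomomorphism = record
        { isRelHomomorphism = record { cong = λ x≈y → x≈y }
        ; homo = λ _ _ → Group.refl G
        }
      ; ε-homo = Group.refl G
      }
    ; ⁻¹-homo = λ _ → Group.refl G
    }
  ; injective = λ x≈y → x≈y
  }

HasSubgroupIsomorphicTo⇒monomorphism :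
  (G : Group c ℓ) (H : Group c′ ℓ′) → HasSubgroupIsomorphicTo p G H →
  ∃ (IsGroupMonomorphism (Group.rawGroup H) (Group.rawGroup G))
HasSubgroupIsomorphicTo⇒monomorphism G H (K , f , f-iso) =
  _ , Composition.isGroupMonomorphism (Group.trans G)
        (inverse-isGroupMonomorphism (Subgroup.group K) H f-iso)
        (inclusion-isGroupMonomorphism G K)

-- Elements are compared through their indices in `Fin n`. This is where finiteness of `G` enters:
-- it makes membership in `image S` decidable.
IsFinite⇒≈-dec : (G : Group c ℓ) → IsFinite G → Decidable (Group._≈_ G)
IsFinite⇒≈-dec G (_ , Fin⤖G) =
  Fin.inj⇒≟ (Inverse⇒Injection (Symmetry.inverse (Bijection⇒Inverse Fin⤖G)))

-- Transfer of sequencings along a monomorphism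

module _
  (G : Group c ℓ) (_≟_ : Decidable (Group._≈_ G)) (H : Group 0ℓ 0ℓ)
  (elements : List (Group.Carrier H)) (complete : ∀ x → x ∈ elements)
  {φ : Group.Carrier H → Group.Carrier G}
  (φ-mono : IsGroupMonomorphism (Group.rawGroup H) (Group.rawGroup G) φ)
  where

  private
    module G = Group G
    module H = Group H
    module φ = IsGroupMonomorphism φ-mono
  open SetoidMembership H.setoid renaming (_∈_ to _∈ᴴ_) using ()
  open SetoidEquality G.setoid using (_≋_; ≋-sym; Unique-resp-≋)
  open SetoidUnique G.setoid renaming (Unique to Uniqueᴳ) using ()
  open SetoidUnique H.setoid renaming (Unique to Uniqueᴴ) using ()

  -- Membership is decided by searching `elements` for a preimage. With `H` at level `0ℓ` the
  -- existential lands in the level that `NonIdentitySubset G` demands.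
  image : NonIdentitySubset H → NonIdentitySubset G
  image S = record
    { member   = λ g → ∃ λ h → S.member h × φ h G.≈ g
    ; respects = λ g≈g′ (h , h∈S , φh≈g) → h , h∈S , G.trans φh≈g g≈g′
    ; member?  = λ g → map′
        Any.satisfied
        (λ (h , Ph) → lose (complete h) Ph)
        (Any.any? (λ h → S.member? h ×-dec (φ h ≟ g)) elements)
    ; ε∉       = λ (h , h∈S , φh≈ε) →
        S.ε∉ (S.respects (φ.injective (G.trans φh≈ε (G.sym φ.ε-homo))) h∈S)
    }
    where module S = NonIdentitySubset S

  preimages : ∀ {gs} → All (λ g → ∃ λ h → φ h G.≈ g) gs → ∃ λ hs → map φ hs ≋ gs
  preimages []                 = [] , []
  preimages ((h , φh≈g) ∷ pre) =
    let hs , φhs≋gs = preimages pre in h ∷ hs , φh≈g ∷ φhs≋gs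

  φ-step : ∀ {e e′ h g} → φ e G.≈ e′ → φ h G.≈ g → φ (e H.∙ h) G.≈ e′ G.∙ g
  φ-step φe≈e′ φh≈g = G.trans (φ.∙-homo _ _) (G.∙-cong φe≈e′ φh≈g)

  -- The accumulators `e` and `e′` are arbitrary because the recursion moves them; the uses below
  -- start from `φ.ε-homo`.
  scanl-φ : ∀ {e e′ hs gs} → φ e G.≈ e′ → map φ hs ≋ gs →
            map φ (scanl H._∙_ e hs) ≋ scanl G._∙_ e′ gs
  scanl-φ {hs = []}    φe≈e′ []              = φe≈e′ ∷ []
  scanl-φ {hs = _ ∷ _} φe≈e′ (φh≈g ∷ φhs≋gs) =
    φe≈e′ ∷ scanl-φ (φ-step φe≈e′ φh≈g) φhs≋gs

  tail-scanl⁺-φ : ∀ {e e′ hs gs} → φ e G.≈ e′ → map φ hs ≋ gs →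
    map φ (List⁺.tail (scanl⁺ H._∙_ e hs)) ≋ List⁺.tail (scanl⁺ G._∙_ e′ gs)
  tail-scanl⁺-φ φe≈e′ φhs≋gs with _ ∷ eq ← scanl-φ φe≈e′ φhs≋gs = eq

  foldl-φ : ∀ {e e′ hs gs} → φ e G.≈ e′ → map φ hs ≋ gs →
            φ (foldl H._∙_ e hs) G.≈ foldl G._∙_ e′ gs
  foldl-φ {hs = []}    φe≈e′ []              = φe≈e′
  foldl-φ {hs = _ ∷ _} φe≈e′ (φh≈g ∷ φhs≋gs) = foldl-φ (φ-step φe≈e′ φh≈g) φhs≋gs

  -- Equal entries of `hs` would have equal images under `φ`.
  unique-reflect : ∀ {hs gs} → map φ hs ≋ gs → Uniqueᴳ gs → Uniqueᴴ hs
  unique-reflect φhs≋gs gs! = SetoidUniqueₚ.map⁻ H.setoid G.setoid φ.⟦⟧-cong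
    (Unique-resp-≋ (≋-sym φhs≋gs) gs!)

  isOrderingOf-reflect : ∀ S {hs gs} → map φ hs ≋ gs →
                         IsOrderingOf G (image S) gs → IsOrderingOf H S hs
  isOrderingOf-reflect S {hs} {gs} φhs≋gs (gs! , gs∼S) =
    unique-reflect φhs≋gs gs! , λ h → mk⇔ (to h) (from h)
    where
    module S = NonIdentitySubset S

    to : ∀ h → h ∈ᴴ hs → S.member h
    to h h∈hs =
      -- Membership of `φ h` in the image yields some `h′` in `S`, possibly other than `h`;
      -- injectivity identifies the two.
      let h′ , h′∈S , φh′≈φh = Equivalence.to (gs∼S (φ h))
            (SetoidMembershipₚ.∈-resp-≋ G.setoid φhs≋gs
              (SetoidMembershipₚ.∈-map⁺ H.setoid G.setoid φ.⟦⟧-cong h∈hs))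
      in S.respects (φ.injective φh′≈φh) h′∈S

    from : ∀ h → S.member h → h ∈ᴴ hs
    from h h∈S = Any.map φ.injective (Any.map⁻
      (SetoidMembershipₚ.∈-resp-≋ G.setoid (≋-sym φhs≋gs)
        (Equivalence.from (gs∼S (φ h)) (h , h∈S , G.refl))))

  ordering-preimages : ∀ S {gs} → IsOrderingOf G (image S) gs → ∃ λ hs → map φ hs ≋ gs
  ordering-preimages S (_ , gs∼S) = preimages (All.tabulateₛ G.setoid
    (λ g∈gs → let h , _ , φh≈g = Equivalence.to (gs∼S _) g∈gs in h , φh≈g))

  -- An ordering of `image S` consists of images, so it lifts to a list over `H`. The map `φ`
  -- carries partial products to partial products, hence distinctness and, by injectivity, a trivial
  -- total product come back to `H`.
  stronglySequenceable-reflect : StronglySequenceable G → StronglySequenceable H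
  stronglySequenceable-reflect ss S = Sum.map
    (λ (gs , ord , h!) →
      let hs , φhs≋gs = ordering-preimages S ord in
      hs , isOrderingOf-reflect S φhs≋gs ord ,
      unique-reflect (scanl-φ φ.ε-homo φhs≋gs) h!)
    (λ (gs , ord , h! , hₖ≈ε) →
      let hs , φhs≋gs = ordering-preimages S ord in
      hs , isOrderingOf-reflect S φhs≋gs ord ,
      unique-reflect (tail-scanl⁺-φ φ.ε-homo φhs≋gs) h! ,
      φ.injective (G.trans (foldl-φ φ.ε-homo φhs≋gs) (G.trans hₖ≈ε (G.sym φ.ε-homo))))
    (ss (image S))

-- Listing all permutations

module _ {A : Set a} where

  insertions : A → List A → List (List A)
  insertions x []       = [ [ x ] ]
  insertions x (y ∷ ys) = (x ∷ y ∷ ys) ∷ map (y ∷_) (insertions x ys)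

  permutations : List A → List (List A)
  permutations []       = [ [] ]
  permutations (x ∷ xs) = concatMap (insertions x) (permutations xs)

  ∈-insertions : ∀ x ys {zs} → ys ++ x ∷ zs ∈ insertions x (ys ++ zs)
  ∈-insertions x []       {[]}    = here refl
  ∈-insertions x []       {_ ∷ _} = here refl
  ∈-insertions x (y ∷ ys)         = there (∈-map⁺ (y ∷_) (∈-insertions x ys))

  -- Induction on `xs`: cutting `ys` at an occurrence of `x` and deleting it leaves a permutation of
  -- the tail, into which `x` is reinserted at the cut.
  ↭⇒∈-permutations : ∀ {xs ys} → ys ↭ xs → ys ∈ permutations xs
  ↭⇒∈-permutations {[]}     ys↭xs with refl ← ↭-empty-inv ys↭xs = here refl
  ↭⇒∈-permutations {x ∷ xs} ys↭xs
    with ys₁ , ys₂ , refl ← ∈-∃++ (∈-resp-↭ (↭-sym ys↭xs) (here refl)) =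
    ∈-concatMap⁺ (insertions x)
      (lose (↭⇒∈-permutations {xs} (drop-mid ys₁ [] ys↭xs)) (∈-insertions x ys₁))

-- Exhaustive search over the orderings of a finite subset

module OrderingSearch
  {A : Set} (_≟_ : DecidableEquality A)
  {_∙_ : A → A → A} {ε : A} {_⁻¹ : A → A} (isGroup : IsGroup _≡_ _∙_ ε _⁻¹)
  (xs : List A)
  where

  open DecUnique _≟_ using (Unique; unique?)
  open DecMembership _≟_ using (_∈?_)

  private
    H : Group 0ℓ 0ℓ
    H = record { isGroup = isGroup }

  Obstructed : List A → Set
  Obstructed hs =
    ¬ Unique (scanl _∙_ ε hs) ×
    ¬ (Unique (List⁺.tail (scanl⁺ _∙_ ε hs)) × foldl _∙_ ε hs ≡ ε)

  allObstructed? : Dec (All Obstructed (permutations xs))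
  allObstructed? = All.all?
    (λ hs → ¬? (unique? (scanl _∙_ ε hs)) ×-dec
            ¬? (unique? (List⁺.tail (scanl⁺ _∙_ ε hs)) ×-dec (foldl _∙_ ε hs ≟ ε)))
    (permutations xs)

  -- The three `True` and `False` premises reduce to the unit type on concrete data, so the type
  -- checker performs the search when they are given as `_`.
  ¬stronglySequenceable : True (unique? xs) → False (ε ∈? xs) → True allObstructed? →
                          ¬ StronglySequenceable H
  ¬stronglySequenceable xs! ε∉xs obs ss =
    [ (λ (hs , ord , h!) → proj₁ (obstructed ord) h!)
    , (λ (hs , ord , rot) → proj₂ (obstructed ord) rot)
    ]′ (ss S)
    where
    S : NonIdentitySubset H
    S = record
      { member   = _∈ xs
      ; respects = subst (_∈ xs)
      ; member?  = _∈? xs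
      ; ε∉       = toWitnessFalse ε∉xs
      }

    obstructed : ∀ {hs} → IsOrderingOf H S hs → Obstructed hs
    -- Two duplicate-free lists with the same elements are equal as bags, hence permutations of each
    -- other.
    obstructed (hs! , hs∼S) = All.lookup (toWitness obs)
      (↭⇒∈-permutations (∼bag⇒↭ (unique∧set⇒bag hs! (toWitness xs!) (hs∼S _))))

-- The two obstructing groups and the conclusion

D₆-¬stronglySequenceable : ¬ StronglySequenceable D₆
D₆-¬stronglySequenceable = OrderingSearch.¬stronglySequenceable
  -- The identity `(zero , false)` comes first in `elements`, so `drop 1` removes exactly it; 120
  -- orderings remain to be checked.
  (≡-dec Fin._≟_ Bool._≟_) (Group.isGroup D₆) (drop 1 Dihedral₆.elements) _ _ _

Q₈-¬stronglySequenceable : ¬ StronglySequenceable Q₈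
Q₈-¬stronglySequenceable = OrderingSearch.¬stronglySequenceable
  (≡-dec Sign._≟_ _≟ᵘ_) (Group.isGroup Q₈)
  -- The elements of order 4; the central involution is left out along with the identity. There are
  -- 720 orderings.
  ((+ , i) ∷ (+ , j) ∷ (+ , k) ∷ (- , i) ∷ (- , j) ∷ (- , k) ∷ []) _ _ _
  where open Quaternion₈ using (i; j; k; _≟ᵘ_)

theorem6p1 : ∀ {c ℓ p} (G : Group c ℓ) → IsFinite G →
    HasSubgroupIsomorphicTo p G D₆ ⊎ HasSubgroupIsomorphicTo p G Q₈ →
    ¬ StronglySequenceable G
theorem6p1 G fin (inj₁ D₆≤G) ss =
  let _ , φ-mono = HasSubgroupIsomorphicTo⇒monomorphism G D₆ D₆≤G in
  D₆-¬stronglySequenceable (stronglySequenceable-reflect G (IsFinite⇒≈-dec G fin)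
    D₆ Dihedral₆.elements Dihedral₆.complete φ-mono ss)
theorem6p1 G fin (inj₂ Q₈≤G) ss =
  let _ , φ-mono = HasSubgroupIsomorphicTo⇒monomorphism G Q₈ Q₈≤G in
  Q₈-¬stronglySequenceable (stronglySequenceable-reflect G (IsFinite⇒≈-dec G fin)
    Q₈ Quaternion₈.elements Quaternion₈.complete φ-mono ss)
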